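{- Let $\mathcal{B}$ be a set and let $H,H'\subseteq 2^{\mathcal{B}}$ be downward-closed compsets. Then their composition is $$H\times H'=\bigcup_{M\in\overline{H},\ M'\in\overline{H'}}2^{M\cap M'}=\langle M\cap M'\rangle_{M\in\overline{H},\ M'\in\overline{H'}}.$$ Therefore, if $H$ is $k$-conic and $H'$ is $k'$-conic, then $H\times H'$ is at most $kk'$-conic, i.e. it is $m$-conic for some $m\le kk'$.
   Context: Components are subsets of a fixed set $\mathcal{B}$ of behaviors, ordered by inclusion, with composition given by intersection. A compset is a set of components $H\subseteq 2^{\mathcal{B}}$; it is downward-closed if $M'\subseteq M\in H$ implies $M'\in H$. $\overline{H}=\{M\in H : \forall M'\in H,\ M\subseteq M'\Rightarrow M'=M\}$ is the set of maximal components of $H$. A downward-closed compset $H$ is called $k$-conic if $\overline{H}$ is finite of cardinality $k$. Here $2^M$ is the set of all subsets of $M$, and $\langle M_i\rangle_{i}$ denotes the downward-closed compset $\bigcup_i 2^{M_i}$. Composition of compsets is $H\times H'=\{M\cap M' : M\in H,\ M'\in H'\}$.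
   Formalization: The formal theorem adds that every component of H and of H′ lies in a maximal one; without this both claims fail, e.g. for H = H′ = the finite subsets of ℕ, which has no maximal component although ∅ ∈ H×H′. -}

module Defs where

open import Level using (Level; suc)
open import Data.Nat.Base using (ℕ)
open import Data.Fin.Base using (Fin)
open import Data.Product.Base using (∃; ∃-syntax; _×_; proj₁)
open import Function.Bundles using (Bijection)
open import Relation.Binary.Bundles using (Setoid)
open import Relation.Binary.PropositionalEquality.Properties using (setoid)
import Relation.Binary.Construct.On as On
open import Relation.Unary using (Pred; _∈_; _⊆_; _≐_; _∩_; ⋃)
open import Relation.Unary.Relation.Binary.Equality using (≐-setoid)

private
  variable
    ℓ : Level
    B : Set ℓ

-- Subsets are predicates, and two subsets are equal when they are
-- extensionally equal, i.e. related by _≐_.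

Component : Set ℓ → Set (suc ℓ)
Component {ℓ} B = Pred B ℓ

-- A compset is not required to respect _≐_ on components; a
-- downward-closed one does so automatically.

Compset : Set ℓ → Set (suc (suc ℓ))
Compset {ℓ} B = Pred (Component B) (suc ℓ)

DownwardClosed : Compset B → Set _
DownwardClosed {B = B} H = ∀ (M M′ : Component B) → M′ ⊆ M → M ∈ H → M′ ∈ H

Maximal : Compset B → Compset B
Maximal {B = B} H M = M ∈ H × (∀ (M′ : Component B) → M′ ∈ H → M ⊆ M′ → M′ ≐ M)

2^ : {B : Set ℓ} → Component B → Pred (Component B) ℓ
2^ M X = X ⊆ M

⟨_⟩ : {B : Set ℓ} {I : Set (suc ℓ)} → (I → Component B) → Compset B
⟨_⟩ {I = I} M = ⋃ I (λ i → 2^ (M i))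

-- Not every downward-closed compset over an infinite B satisfies this: the
-- compset of all finite subsets of an infinite B has no maximal component.

GeneratedByMaximal : Compset B → Set _
GeneratedByMaximal {B = B} H = H ≐ ⟨ proj₁ {A = Component B} {B = Maximal H} ⟩

infixr 7 _⊗_

_⊗_ : {B : Set ℓ} → Compset B → Compset B → Compset B
_⊗_ H H′ X = ∃[ M ] ∃[ M′ ] (M ∈ H × M′ ∈ H′ × X ≐ M ∩ M′)

-- The maximal components as a set: its equality compares components only,
-- not the proofs of maximality, so that each component is counted once.

MaximalSetoid : {B : Set ℓ} → Compset B → Setoid (suc ℓ) ℓ
MaximalSetoid {ℓ = ℓ} {B = B} H = On.setoid (≐-setoid B ℓ) (proj₁ {A = Component B} {B = Maximal H})

Conic : ℕ → Compset B → Set _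
Conic k H = DownwardClosed H × Bijection (setoid (Fin k)) (MaximalSetoid H)

{-# OPTIONS --safe #-}

-- For downward-closed compsets composition is just intersection, because
-- X = X ∩ X, and 2^M ∩ 2^M′ = 2^(M ∩ M′).  Hence the k k′ pairwise
-- intersections of maximal components generate H ⊗ H′.  A maximal component
-- of a finitely generated compset is one of the generators, so discarding the
-- generators lying strictly below another one, and then the repetitions,
-- enumerates the maximal components; this selection is where excluded middle
-- is used.

module Submission where

open import Defs
open import Axiom.ExcludedMiddle using (ExcludedMiddle)
open import Data.Fin.Base using (Fin; zero; suc)
open import Data.List.Base
  using (List; []; _∷_; length; lookup; map; filter; deduplicate; tabulate; cartesianProductWith)
open import Data.List.Properties
  using (length-++; length-map; length-tabulate; length-filter; length-deduplicate)
open import Data.List.Membership.Propositional using (find; lose) renaming (_∈_ to _∈ₗ_)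
open import Data.List.Membership.Propositional.Properties using (∈-filter⁺; ∈-lookup)
open import Data.List.Relation.Unary.All as All using (All; _∷_; all?)
open import Data.List.Relation.Unary.All.Properties as All using (all-filter)
open import Data.List.Relation.Unary.AllPairs using (_∷_)
open import Data.List.Relation.Unary.Any as Any using (Any)
open import Data.List.Relation.Unary.Any.Properties as Any using (lookup-index)
open import Data.List.Relation.Unary.Unique.Setoid using (Unique)
open import Data.List.Relation.Unary.Unique.DecSetoid.Properties using (deduplicate-!)
open import Data.Nat.Base using (ℕ; _+_; _*_; _≤_)
open import Data.Nat.Properties using (≤-trans; ≤-reflexive)
open import Data.Product.Base using (∃; ∃-syntax; _×_; _,_; proj₁; proj₂)
open import Function.Base using (_∘_)
open import Function.Bundles using (Bijection)
open import Level as Level using (Level)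
open import Relation.Binary.Bundles using (Setoid; DecSetoid)
open import Relation.Binary.PropositionalEquality
  using (_≡_; refl; cong; cong₂; module ≡-Reasoning)
open import Relation.Binary.PropositionalEquality.Properties using (setoid)
open import Relation.Nullary.Negation using (contradiction)
open import Relation.Unary using (_∈_; _⊆_; _≐_; _∩_; ⋃; Decidable)
open import Relation.Unary.Properties using (≐-refl; ≐-sym; ≐-trans)
open import Relation.Unary.Relation.Binary.Equality using (≐-setoid)

private
  variable
    a b c ℓ : Level
    B : Set ℓ
    H H′ : Compset B
    k : ℕ

lookup-injective : (S : Setoid a ℓ) {xs : List (Setoid.Carrier S)} → Unique S xs →
  ∀ i j → Setoid._≈_ S (lookup xs i) (lookup xs j) → i ≡ j
lookup-injective S (_ ∷ _) zero zero _ = refl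
lookup-injective S (x∉xs ∷ _) zero (suc j) x≈y =
  contradiction x≈y (All.lookup x∉xs (∈-lookup j))
lookup-injective S (x∉xs ∷ _) (suc i) zero y≈x =
  contradiction (Setoid.sym S y≈x) (All.lookup x∉xs (∈-lookup i))
lookup-injective S (_ ∷ xs!) (suc i) (suc j) eq =
  cong suc (lookup-injective S xs! i j eq)

length-cartesianProductWith : {A : Set a} {B : Set b} {C : Set c}
  (f : A → B → C) (xs : List A) (ys : List B) →
  length (cartesianProductWith f xs ys) ≡ length xs * length ys
length-cartesianProductWith f [] ys = refl
length-cartesianProductWith f (x ∷ xs) ys = begin
  length (cartesianProductWith f (x ∷ xs) ys)
    ≡⟨ length-++ (map (f x) ys) ⟩
  length (map (f x) ys) + length (cartesianProductWith f xs ys)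
    ≡⟨ cong₂ _+_ (length-map (f x) ys) (length-cartesianProductWith f xs ys) ⟩
  length ys + length xs * length ys
    ∎
  where open ≡-Reasoning

⊗≐∩ : DownwardClosed H → DownwardClosed H′ → H ⊗ H′ ≐ H ∩ H′
⊗≐∩ dc dc′ =
  (λ {X} (M , M′ , M∈H , M′∈H′ , X≐) →
    dc M X (λ x → proj₁ (proj₁ X≐ x)) M∈H , dc′ M′ X (λ x → proj₂ (proj₁ X≐ x)) M′∈H′) ,
  (λ {X} (X∈H , X∈H′) → X , X , X∈H , X∈H′ , (λ x → x , x) , proj₁)

-- A common component lies below a maximal one of `H` and one of `H′`, hence below their
-- intersection. Conversely, anything below that intersection is in both compsets.
⊗-generated : DownwardClosed H → DownwardClosed H′ →
  GeneratedByMaximal H → GeneratedByMaximal H′ →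
  H ⊗ H′ ≐ ⟨ (λ (((M , _) , (M′ , _)) : ∃ (Maximal H) × ∃ (Maximal H′)) → M ∩ M′) ⟩
⊗-generated {H = H} {H′ = H′} dc dc′ gen gen′ = ≐-trans (⊗≐∩ dc dc′) ∩-generated
  where
  ∩-generated :
    H ∩ H′ ≐ ⟨ (λ (((M , _) , (M′ , _)) : ∃ (Maximal H) × ∃ (Maximal H′)) → M ∩ M′) ⟩
  ∩-generated =
    (λ (X∈H , X∈H′) →
      let M , X⊆M = proj₁ gen X∈H
          M′ , X⊆M′ = proj₁ gen′ X∈H′
      in (M , M′) , λ x → X⊆M x , X⊆M′ x) ,
    (λ ((M , M′) , X⊆M∩M′) →
      proj₂ gen (M , λ x → proj₁ (X⊆M∩M′ x)) ,
      proj₂ gen′ (M′ , λ x → proj₂ (X⊆M∩M′ x)))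

⊗-downwardClosed : DownwardClosed H → DownwardClosed H′ → DownwardClosed (H ⊗ H′)
⊗-downwardClosed dc dc′ M M′ M′⊆M M∈ =
  let M∈H , M∈H′ = proj₁ (⊗≐∩ dc dc′) M∈
  in proj₂ (⊗≐∩ dc dc′) (dc M M′ M′⊆M M∈H , dc′ M M′ M′⊆M M∈H′)

-- A finite form of `⟨_⟩`: the length of the list bounds the number of generators, and lists can be
-- filtered and deduplicated.
↓ : List (Component B) → Compset B
↓ Ms X = Any (λ M → X ∈ 2^ M) Ms

↓-∩ : (Ms Ms′ : List (Component B)) →
  ↓ (cartesianProductWith _∩_ Ms Ms′) ≐ ↓ Ms ∩ ↓ Ms′
↓-∩ Ms Ms′ =
  (λ {X} → Any.cartesianProductWith⁻ _∩_ {R = X ⊆_} {P = X ⊆_} {Q = X ⊆_}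
    (λ X⊆ → (λ x → proj₁ (X⊆ x)) , (λ x → proj₂ (X⊆ x))) Ms Ms′) ,
  (λ {X} (X∈ , X∈′) →
    Any.cartesianProductWith⁺ _∩_ {P = X ⊆_} {Q = X ⊆_} {R = X ⊆_}
      (λ X⊆M X⊆M′ x → X⊆M x , X⊆M′ x) X∈ X∈′)

-- `Conic` only counts the maximal components; `gen` is what puts every component below one of them.
-- Surjectivity of the enumeration then replaces that one by a listed set equal to it up to `≐`.
conic⇒generators : GeneratedByMaximal H → Conic k H →
  ∃[ Ms ] (length Ms ≡ k × H ≐ ↓ Ms)
conic⇒generators {H = H} gen (_ , bij) =
  tabulate M , length-tabulate M ,
  (λ X∈H → let (N , N-max) , X⊆N = proj₁ gen X∈H
               i , Mi≐N = surjective (N , N-max)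
           in Any.tabulate⁺ i (λ x → proj₂ (Mi≐N refl) (X⊆N x))) ,
  (λ X∈↓ → let i , X⊆Mi = Any.tabulate⁻ X∈↓ in proj₂ gen (to i , X⊆Mi))
  where
  open Bijection bij
  M = proj₁ ∘ to

-- Absence of repetitions up to `≐` gives injectivity, completeness gives surjectivity.
enumeration⇒bijection : {B : Set ℓ} {H : Compset B} {Ms : List (Component B)} →
  Unique (≐-setoid B ℓ) Ms → All (Maximal H) Ms →
  (∀ {M} → Maximal H M → Any (M ≐_) Ms) →
  Bijection (setoid (Fin (length Ms))) (MaximalSetoid H)
enumeration⇒bijection {Ms = Ms} Ms! max complete = record
  { to = λ i → lookup Ms i , All.lookup max (∈-lookup i)
  ; cong = λ { refl → ≐-refl }
  ; bijective = lookup-injective (≐-setoid _ _) Ms! _ _ ,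
      λ (M , M-max) → Any.index (complete M-max) ,
        λ { refl → ≐-sym (lookup-index (complete M-max)) }
  }

module _ {B : Set ℓ} {H : Compset B} (em : ExcludedMiddle ℓ) (dc : DownwardClosed H)
  (Ms : List (Component B)) (H≐↓Ms : H ≐ ↓ Ms) where

  private
    ≐-decSetoid : DecSetoid (Level.suc ℓ) ℓ
    ≐-decSetoid = record
      { isDecEquivalence = record
        { isEquivalence = Setoid.isEquivalence (≐-setoid B ℓ) ; _≟_ = λ _ _ → em } }

    open DecSetoid ≐-decSetoid using (_≟_)

    -- Maximality tested against the generators alone: a finite conjunction of statements in
    -- `Set ℓ`, so excluded middle at level `ℓ` decides it.
    Top : Compset B
    Top M = All (λ N → M ⊆ N → N ⊆ M) Ms

    top? : Decidable Top
    top? M = all? (λ _ → em) Ms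

    tops maximals : List (Component B)
    tops = filter top? Ms
    maximals = deduplicate _≟_ tops

    generator∈H : ∀ {M} → M ∈ₗ Ms → H M
    generator∈H M∈Ms = proj₂ H≐↓Ms (lose M∈Ms (λ x → x))

    -- Any `M′` in `H` above `M` lies below a generator `N`, and the test on `N` closes the cycle
    -- `M ⊆ M′ ⊆ N ⊆ M`.
    top⇒maximal : ∀ {M} → H M → Top M → Maximal H M
    top⇒maximal M∈H M-top = M∈H , λ M′ M′∈H M⊆M′ →
      let N , N∈Ms , M′⊆N = find (proj₁ H≐↓Ms M′∈H)
          N⊆M = All.lookup M-top N∈Ms (λ x → M′⊆N (M⊆M′ x))
      in (λ x → N⊆M (M′⊆N x)) , M⊆M′

    -- A maximal `M` lies below some generator `N`, and maximality forces `N ≐ M`.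
    maximal⇒tops : ∀ {M} → Maximal H M → Any (M ≐_) tops
    maximal⇒tops {M} (M∈H , M-max) =
      let N , N∈Ms , M⊆N = find (proj₁ H≐↓Ms M∈H)
          N⊆M , _ = M-max N (generator∈H N∈Ms) M⊆N
          N-top : Top N
          -- A generator `L` above `N` is also above `M`, so `L ⊆ M ⊆ N`.
          N-top = All.tabulate λ {L} L∈Ms N⊆L x →
            M⊆N (proj₁ (M-max L (generator∈H L∈Ms) (λ y → N⊆L (M⊆N y))) x)
      in lose (∈-filter⁺ top? N∈Ms N-top) ((λ x → M⊆N x) , λ x → N⊆M x)

    maximals-maximal : All (Maximal H) maximals
    maximals-maximal = All.deduplicate⁺ _≟_
      (All.zipWith (λ (M∈H , M-top) → top⇒maximal M∈H M-top)
        (All.filter⁺ top? (All.tabulate generator∈H) , all-filter top? Ms))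

    maximal⇒maximals : ∀ {M} → Maximal H M → Any (M ≐_) maximals
    maximal⇒maximals M-max =
      -- Deduplication may keep another representative of the same set, so being equal to `M` has to
      -- be invariant under `≐`.
      Any.deduplicate⁺ _≟_ (λ N≐L M≐L → ≐-trans M≐L (≐-sym N≐L)) (maximal⇒tops M-max)

  -- Only a bound on `m` results, since filtering and deduplication both may shorten the list.
  finitelyGenerated⇒conic : ∃[ m ] (m ≤ length Ms × Conic m H)
  finitelyGenerated⇒conic = length maximals ,
    ≤-trans (length-deduplicate _≟_ tops) (length-filter top? Ms) ,
    dc , enumeration⇒bijection (deduplicate-! ≐-decSetoid tops) maximals-maximal maximal⇒maximals

⊗-conic : ∀ {k k′} {B : Set ℓ} {H H′ : Compset B} → ExcludedMiddle ℓ →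
  GeneratedByMaximal H → GeneratedByMaximal H′ → Conic k H → Conic k′ H′ →
  ∃[ m ] (m ≤ k * k′ × Conic m (H ⊗ H′))
⊗-conic em gen gen′ conic@(dc , _) conic′@(dc′ , _) =
  let Ms , |Ms|≡k , H≐ = conic⇒generators gen conic
      Ms′ , |Ms′|≡k′ , H′≐ = conic⇒generators gen′ conic′
      generated = ≐-trans (⊗≐∩ dc dc′) (≐-trans
        ( (λ (X∈H , X∈H′) → proj₁ H≐ X∈H , proj₁ H′≐ X∈H′)
        , (λ (X∈↓ , X∈↓′) → proj₂ H≐ X∈↓ , proj₂ H′≐ X∈↓′))
        (≐-sym (↓-∩ Ms Ms′)))
      m , m≤ , m-conic = finitelyGenerated⇒conic em (⊗-downwardClosed dc dc′)
        (cartesianProductWith _∩_ Ms Ms′) generated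
  in m ,
     ≤-trans m≤ (≤-trans (≤-reflexive (length-cartesianProductWith _∩_ Ms Ms′))
       (≤-reflexive (cong₂ _*_ |Ms|≡k |Ms′|≡k′))) ,
     m-conic

mainTheorem10 : ∀ {ℓ} (B : Set ℓ) (H H′ : Compset B) →
    DownwardClosed H → DownwardClosed H′ →
    GeneratedByMaximal H → GeneratedByMaximal H′ →
    (H ⊗ H′ ≐ ⋃ (∃ (Maximal H) × ∃ (Maximal H′)) (λ ((M , _) , (M′ , _)) → 2^ (M ∩ M′))) ×
    (H ⊗ H′ ≐ ⟨ (λ (((M , _) , (M′ , _)) : ∃ (Maximal H) × ∃ (Maximal H′)) → M ∩ M′) ⟩) ×
    (ExcludedMiddle ℓ → ∀ (k k′ : ℕ) → Conic k H → Conic k′ H′ →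
    ∃[ m ] (m ≤ k * k′ × Conic m (H ⊗ H′)))
mainTheorem10 B H H′ dc dc′ gen gen′ =
  -- `⟨_⟩` unfolds to the union of the power sets, so one proof serves both equalities.
  ⊗-generated dc dc′ gen gen′ ,
  ⊗-generated dc dc′ gen gen′ ,
  λ em k k′ → ⊗-conic em gen gen′
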